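{- Let $G$ be a finite impartial game that is nimber-like. Then $G\equiv *n$ for some nonnegative integer $n$.
   Context: A game is identified with its set of options (written $\{g_1,\dots,g_k\}$); $\mathbf{E}$ denotes the game with no options, and $G\equiv H$ means $G$ and $H$ have the same set of options, recursively. Nimbers: $*0\equiv\mathbf{E}$ and $*n\equiv\{*0,*1,\dots,*(n-1)\}$. A game $G$ has hereditary transitivity if whenever $g$ is an option of $G$ and $g'$ is an option of $g$, then $g'$ is (identical to) an option of $G$. A game is nimber-like if it has hereditary transitivity and each of its options is nimber-like (recursively; equivalently, $G$ and every game reachable from $G$ by a sequence of moves has hereditary transitivity). -}

module Defs where

open import Data.List.Base using (List; []; _∷_)
open import Data.List.Relation.Unary.All as All using (All; []; _∷_)
open import Data.List.Relation.Unary.Any using (Any; here; there)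
open import Data.Nat.Base using (ℕ; zero; suc)
open import Level using (0ℓ)
open import Relation.Binary.Bundles using (Setoid)
import Data.List.Membership.Setoid as Membership

-- Finite impartial games: finitely many options at every position, and, the
-- type being inductive, no infinite play.  The order and repetition of the
-- listed options are irrelevant; games are only ever compared up to _≅_.
data Game : Set where
  ⟅_⟆ : List Game → Game

options : Game → List Game
options ⟅ gs ⟆ = gs

infix 4 _≅_

-- The identity of games (written G ≡ H in the literature): the same set of
-- options, recursively.  It is not equality of outcomes or Grundy values.
data _≅_ : Game → Game → Set where
  sameOptions : ∀ {gs hs} →
                All (λ g → Any (λ h → g ≅ h) hs) gs →
                All (λ h → Any (λ g → h ≅ g) gs) hs →
                ⟅ gs ⟆ ≅ ⟅ hs ⟆

mutual
  ≅-refl : ∀ {G} → G ≅ G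
  ≅-refl {⟅ gs ⟆} = sameOptions (⊆-refl gs) (⊆-refl gs)

  ⊆-refl : ∀ gs → All (λ g → Any (g ≅_) gs) gs
  ⊆-refl []       = []
  ⊆-refl (g ∷ gs) = here ≅-refl ∷ All.map there (⊆-refl gs)

≅-sym : ∀ {G H} → G ≅ H → H ≅ G
≅-sym (sameOptions p q) = sameOptions q p

mutual
  ≅-trans : ∀ {G H K} → G ≅ H → H ≅ K → G ≅ K
  ≅-trans (sameOptions p q) (sameOptions r s) =
    sameOptions (⊆-trans p r) (⊆-trans s q)

  ⊆-trans : ∀ {gs hs ks} →
            All (λ g → Any (g ≅_) hs) gs → All (λ h → Any (h ≅_) ks) hs →
            All (λ g → Any (g ≅_) ks) gs
  ⊆-trans []       r = []
  ⊆-trans (a ∷ p) r = ∈-⊆ a r ∷ ⊆-trans p r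

  ∈-⊆ : ∀ {g hs ks} →
        Any (g ≅_) hs → All (λ h → Any (h ≅_) ks) hs → Any (g ≅_) ks
  ∈-⊆ (here e)  (b ∷ r) = ∈-≅ e b
  ∈-⊆ (there a) (b ∷ r) = ∈-⊆ a r

  ∈-≅ : ∀ {g h ks} → g ≅ h → Any (h ≅_) ks → Any (g ≅_) ks
  ∈-≅ e (here f)  = here (≅-trans e f)
  ∈-≅ e (there b) = there (∈-≅ e b)

gameSetoid : Setoid 0ℓ 0ℓ
gameSetoid = record
  { Carrier       = Game
  ; _≈_           = _≅_
  ; isEquivalence = record { refl = ≅-refl ; sym = ≅-sym ; trans = ≅-trans }
  }

open Membership gameSetoid using (_∈_)

infix 4 _IsOptionOf_

-- Membership up to _≅_, since a game is identified with its set of options.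
_IsOptionOf_ : Game → Game → Set
g IsOptionOf G = g ∈ options G

HereditarilyTransitive : Game → Set
HereditarilyTransitive G =
  ∀ {g g′} → g IsOptionOf G → g′ IsOptionOf g → g′ IsOptionOf G

data NimberLike (G : Game) : Set where
  nimberLike : HereditarilyTransitive G →
               (∀ {g} → g IsOptionOf G → NimberLike g) →
               NimberLike G

mutual
  nimber : ℕ → Game
  nimber n = ⟅ nimbersBelow n ⟆

  nimbersBelow : ℕ → List Game
  nimbersBelow zero    = []
  nimbersBelow (suc n) = nimber n ∷ nimbersBelow n

{-# OPTIONS --safe #-}
-- If the options of G are nimbers and *m is the largest of them, transitivity
-- makes every option of *m an option of G, so that G has exactly the options
-- *0, …, *m of *(m + 1); without options, G is *0.
module Submission where

import Data.List.Membership.Setoid as Membership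
open import Data.List.Relation.Unary.All as All using (All; []; _∷_; tabulateₛ)
open import Data.List.Relation.Unary.Any using (here; there)
open import Data.Nat.Base using (zero; suc; _<_; _≤′_; ≤′-refl; ≤′-step)
open import Data.Nat.Properties using (≤⇒≤′; ≤-<-connex)
open import Data.Product using (_×_; _,_; ∃-syntax)
open import Data.Sum.Base using (inj₁; inj₂)
open import Relation.Binary.PropositionalEquality using (_≡_; refl)
open import Defs

open Membership gameSetoid using (_∈_)

nimbersBelow-mono : ∀ {g m n} → m ≤′ n → g ∈ nimbersBelow m → g ∈ nimbersBelow n
nimbersBelow-mono ≤′-refl       g∈ = g∈
nimbersBelow-mono (≤′-step m≤n) g∈ = there (nimbersBelow-mono m≤n g∈)

nimber-∈-nimbersBelow : ∀ {g m n} → m < n → g ≅ nimber m → g ∈ nimbersBelow n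
nimber-∈-nimbersBelow m<n g≅m = nimbersBelow-mono (≤⇒≤′ m<n) (here g≅m)

-- The implication from `n ≡ suc m` says that a nonzero bound is attained; it is vacuous for the
-- empty list, which therefore needs no separate case.
leastNimberBound : ∀ {gs} → All (λ g → ∃[ m ] (g ≅ nimber m)) gs →
                   ∃[ n ] (All (_∈ nimbersBelow n) gs ×
                           (∀ {m} → n ≡ suc m → nimber m ∈ gs))
leastNimberBound [] = zero , [] , λ ()
leastNimberBound ((m , g≅m) ∷ ps) with leastNimberBound ps
... | n , gs⊆n , top with ≤-<-connex n m
-- The bound is exclusive, so `m` equal to `n` already raises it.
...   | inj₁ n≤m = suc m
                 , here g≅m ∷ All.map (λ g∈ → there (nimbersBelow-mono (≤⇒≤′ n≤m) g∈)) gs⊆n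
                 , λ { refl → here (≅-sym g≅m) }
...   | inj₂ m<n = n
                 , nimber-∈-nimbersBelow m<n g≅m ∷ gs⊆n
                 , λ n≡ → there (top n≡)

nimbersBelow-⊆-options : ∀ {G} n → HereditarilyTransitive G →
                         (∀ {m} → n ≡ suc m → nimber m IsOptionOf G) →
                         All (_IsOptionOf G) (nimbersBelow n)
nimbersBelow-⊆-options zero    trans top = []
nimbersBelow-⊆-options (suc m) trans top =
  -- No induction on `m`: `nimbersBelow m` is by definition the option list of `nimber m`, so one
  -- use of transitivity covers it.
  top refl ∷ tabulateₛ gameSetoid (trans (top refl))

theorem3p3 : (G : Game) → NimberLike G → ∃[ n ] (G ≅ nimber n)
theorem3p3 ⟅ gs ⟆ (nimberLike trans nimberLikeOptions)
  with leastNimberBound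
         -- The recursion descends on the `NimberLike` derivation, since `g` is only `_≅_` to an
         -- entry of `gs`, not a subterm.
         (tabulateₛ gameSetoid λ {g} g∈ → theorem3p3 g (nimberLikeOptions g∈))
... | n , gs⊆n , top = n , sameOptions gs⊆n (nimbersBelow-⊆-options {⟅ gs ⟆} n trans top)
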